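{- Let $\mathcal{S}$ be a nonempty set with a scene space basis $\mathcal{B}$. Let $P,Q$ be programs over $\mathcal{S}$ and $F_P,F_Q:\mathcal{S}\to\{\text{true},\text{false}\}$ formulas such that $P$ does not interfere with $F_Q$ and $Q$ does not interfere with $F_P$. Then $[P]F_P\land[Q]F_Q\implies [P\parallel Q](F_P\land F_Q)$; that is, for every state $s\in\mathcal{S}$, if $([P]F_P)(s)$ and $([Q]F_Q)(s)$ hold then $([P\parallel Q](F_P\land F_Q))(s)$ holds.
   Context: Scenes. Let $\mathcal{S}$ be a nonempty set (of states). A scene on $\mathcal{S}$ is a function $A:\mathcal{S}\to\mathcal{S}\to\mathcal{S}$, also written $\mathrm{mrg}_A$, satisfying for all $x,y,z$: $A\,(A\,x\,y)\,z = A\,x\,z$, $A\,x\,(A\,y\,z)=A\,x\,z$, $A\,x\,x=x$. Write $\bot = (\lambda s_1\,s_2.\ s_1)$, $\top=(\lambda s_1\,s_2.\ s_2)$, $A^{\complement}=(\lambda s_1\,s_2.\ A\,s_2\,s_1)$, $A\sqcup B=(\lambda s_1\,s_2.\ B\,(A\,s_1\,s_2)\,s_2)$. Scenes $A,B$ are independent if $B\,(A\,s_1\,s_2)\,s_3=A\,(B\,s_1\,s_3)\,s_2$ for all $s_1,s_2,s_3$. Write "$s_1\approx s_2$ on $A$" for $A\,s_1\,s_2=s_1$. A scene space basis is a finite sequence of scenes $S_1,\dots,S_n$ with $S_i,S_j$ independent for $i\neq j$ and $S_1\sqcup\cdots\sqcup S_n=\top$; $\mathcal{B}=\{S_1,\dots,S_n\}$.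 For a set $X\subseteq\mathcal{B}$, $\bigcup X$ denotes the $\sqcup$ of all its elements (in any order, the result being independent of it), with $\bigcup\emptyset=\bot$. A program is a binary predicate $P(s,s')$ on $\mathcal{S}$. A formula is a Boolean-valued function on $\mathcal{S}$; conjunction of formulas is pointwise. $FV(F)=\{x\in\mathcal{B} : \exists s,s'.\ s\approx s' \text{ on } x^{\complement} \text{ and } F(s)\ne F(s')\}$. $BV(P)=\{x\in\mathcal{B} : \exists s_0,s_0'.\ P(s_0,s_0') \text{ and not } (s_0\approx s_0' \text{ on } x)\}$. Program $P$ does not interfere with formula $F$ if $BV(P)\cap FV(F)=\emptyset$. Box: $([P]F)(s)$ holds iff $F(s')$ holds for all $s'$ with $P(s,s')$. Parallel composition: $(P\parallel Q)(s,s')$ iff there exist $s_P,s_Q\in\mathcal{S}$ with $P(s,s_P)$, $Q(s,s_Q)$ and $s'=\mathrm{mrg}_{\bigcup BV(P)}\,s_Q\,s_P$. -}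

module Defs where

open import Level using (Level; _⊔_)
open import Algebra.Core using (Op₂)
open import Data.Bool.Base as Bool using (Bool; true)
open import Data.Fin.Base using (Fin; zero; suc)
open import Data.Fin.Properties using (_≟_)
open import Data.List.Base using (List; []; _∷_; foldr; tabulate)
open import Data.List.Relation.Unary.All using (All; []; _∷_)
import Data.List.Relation.Unary.All as All
open import Data.List.Relation.Unary.Any using (Any; here; there)
open import Data.Nat.Base using (ℕ; zero; suc)
open import Data.Product.Base using (_×_; _,_; proj₁; proj₂; ∃; ∃-syntax)
open import Relation.Binary.Core using (Rel)
open import Relation.Binary.PropositionalEquality
  using (_≡_; _≢_; refl; sym; trans; cong; module ≡-Reasoning)
open import Relation.Nullary using (¬_; Dec; yes; no; contradiction)
open import Relation.Unary using (Pred; _∩_; _⊆_; Empty)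

private
  variable
    a p q ℓ : Level

module _ {𝒮 : Set a} where

  infix  4 _≋_
  infixl 6 _⊔ˢ_
  infix  8 _ᶜ

  -- Equality of functions is pointwise, as function extensionality is
  -- not available.
  _≋_ : Rel (Op₂ 𝒮) a
  A ≋ B = ∀ s t → A s t ≡ B s t

  record IsScene (A : Op₂ 𝒮) : Set a where
    field
      overrideˡ  : ∀ x y z → A (A x y) z ≡ A x z
      overrideʳ  : ∀ x y z → A x (A y z) ≡ A x z
      idempotent : ∀ x → A x x ≡ x

  -- The operations are defined on arbitrary binary functions: the join
  -- of two scenes that are not independent need not be a scene.
  ⊥ˢ ⊤ˢ : Op₂ 𝒮
  ⊥ˢ s₁ s₂ = s₁
  ⊤ˢ s₁ s₂ = s₂

  _ᶜ : Op₂ 𝒮 → Op₂ 𝒮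
  (A ᶜ) s₁ s₂ = A s₂ s₁

  _⊔ˢ_ : Op₂ 𝒮 → Op₂ 𝒮 → Op₂ 𝒮
  (A ⊔ˢ B) s₁ s₂ = B (A s₁ s₂) s₂

  -- The operation _⊔ˢ_ is associative with unit ⊥ˢ, definitionally.
  ⨆ : List (Op₂ 𝒮) → Op₂ 𝒮
  ⨆ = foldr _⊔ˢ_ ⊥ˢ

  Independent : Rel (Op₂ 𝒮) a
  Independent A B = ∀ s₁ s₂ s₃ → B (A s₁ s₂) s₃ ≡ A (B s₁ s₃) s₂

  _≈_on_ : 𝒮 → 𝒮 → Op₂ 𝒮 → Set a
  s₁ ≈ s₂ on A = A s₁ s₂ ≡ s₁

  -- X is a set of functions up to ≋, and U is the join of the elements
  -- of X listed in some order.  A relation is used because choosing a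
  -- listing of X amounts to deciding which basis scenes lie in X.  For
  -- subsets of a basis, the join is unique (⋃-unique), exists when X is
  -- decidable on the basis (⋃-exists), and never fails to exist
  -- (⋃-¬¬exists); repetitions in the listing are harmless.
  _Enumerates_ : List (Op₂ 𝒮) → Pred (Op₂ 𝒮) ℓ → Set (a ⊔ ℓ)
  xs Enumerates X = All X xs × (∀ x → X x → Any (x ≋_) xs)

  _Is⋃_ : Op₂ 𝒮 → Pred (Op₂ 𝒮) ℓ → Set (a ⊔ ℓ)
  U Is⋃ X = ∃[ xs ] xs Enumerates X × U ≋ ⨆ xs

record SceneSpaceBasis (𝒮 : Set a) : Set a where
  field
    n           : ℕ
    S           : Fin n → Op₂ 𝒮
    isScene     : ∀ i → IsScene (S i)
    independent : ∀ {i j} → i ≢ j → Independent (S i) (S j)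
    total       : ⨆ (tabulate S) ≋ ⊤ˢ

  Basis : Pred (Op₂ 𝒮) a
  Basis x = ∃[ i ] x ≋ S i

Program : Set a → (p : Level) → Set _
Program 𝒮 p = Rel 𝒮 p

Formula : Set a → Set a
Formula 𝒮 = 𝒮 → Bool

infixr 6 _∧_
infixr 7 [_]_

_∧_ : {𝒮 : Set a} → Formula 𝒮 → Formula 𝒮 → Formula 𝒮
(F ∧ G) s = F s Bool.∧ G s

[_]_ : {𝒮 : Set a} → Program 𝒮 p → Formula 𝒮 → Pred 𝒮 (a ⊔ p)
([ P ] F) s = ∀ s′ → P s s′ → F s′ ≡ true

module SceneSpace {𝒮 : Set a} (𝓑 : SceneSpaceBasis 𝒮) where

  open SceneSpaceBasis 𝓑

  FV : Formula 𝒮 → Pred (Op₂ 𝒮) a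
  FV F x = Basis x × ∃[ s ] ∃[ s′ ] s ≈ s′ on (x ᶜ) × F s ≢ F s′

  BV : Program 𝒮 p → Pred (Op₂ 𝒮) (a ⊔ p)
  BV P x = Basis x × ∃[ s₀ ] ∃[ s₀′ ] P s₀ s₀′ × ¬ (s₀ ≈ s₀′ on x)

  _DoesNotInterfereWith_ : Program 𝒮 p → Formula 𝒮 → Set (a ⊔ p)
  P DoesNotInterfereWith F = Empty (BV P ∩ FV F)

  infixr 5 _∥_

  _∥_ : Program 𝒮 p → Program 𝒮 q → Program 𝒮 (a ⊔ p ⊔ q)
  (P ∥ Q) s s′ = ∃[ sP ] ∃[ sQ ] P s sP × Q s sQ ×
                 ∃[ mrg ] mrg Is⋃ BV P × s′ ≡ mrg sQ sP

  private
    ⊔ˢ-comm : ∀ {A B} → Basis A → Basis B → A ⊔ˢ B ≋ B ⊔ˢ A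
    ⊔ˢ-comm {A} {B} (i , A≋) (j , B≋) s t
      rewrite A≋ s t | B≋ s t | B≋ (S i s t) t | A≋ (S j s t) t
      with i ≟ j
    ... | yes refl = refl
    ... | no i≢j   = independent i≢j s t t

    absorb : ∀ {x} ys → Basis x → All Basis ys → Any (x ≋_) ys →
             ∀ s t → ⨆ ys (x s t) t ≡ ⨆ ys s t
    absorb (y ∷ ys) _ ((i , y≋) ∷ _) (here x≋y) s t
      rewrite x≋y s t | y≋ s t | y≋ (S i s t) t =
      cong (λ u → ⨆ ys u t) (IsScene.overrideˡ (isScene i) s t t)
    absorb {x} (y ∷ ys) bx (by ∷ bys) (there x∈ys) s t =
      trans (cong (λ u → ⨆ ys u t) (⊔ˢ-comm bx by s t))
            (absorb ys bx bys x∈ys (y s t) t)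

    absorb* : ∀ xs ys → All Basis xs → All Basis ys →
              All (λ x → Any (x ≋_) ys) xs →
              ∀ s t → ⨆ ys (⨆ xs s t) t ≡ ⨆ ys s t
    absorb* []       ys _          _   _           s t = refl
    absorb* (x ∷ xs) ys (bx ∷ bxs) bys (x∈ ∷ xs⊆) s t =
      trans (absorb* xs ys bxs bys xs⊆ (x s t) t) (absorb ys bx bys x∈ s t)

    push : ∀ {x} ys → Basis x → All Basis ys →
           ∀ s t → ⨆ ys (x s t) t ≡ x (⨆ ys s t) t
    push []       _  _          s t = refl
    push (y ∷ ys) bx (by ∷ bys) s t =
      trans (cong (λ u → ⨆ ys u t) (⊔ˢ-comm bx by s t))
            (push ys bx bys (y s t) t)

    push* : ∀ xs ys → All Basis xs → All Basis ys →
            ∀ s t → ⨆ ys (⨆ xs s t) t ≡ ⨆ xs (⨆ ys s t) t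
    push* []       ys _          _   s t = refl
    push* (x ∷ xs) ys (bx ∷ bxs) bys s t =
      trans (push* xs ys bxs bys (x s t) t)
            (cong (λ u → ⨆ xs u t) (push ys bx bys s t))

    ¬¬-finite : ∀ {m} (Y : Pred (Fin m) ℓ) → ¬ ¬ (∀ i → Dec (Y i))
    ¬¬-finite {m = zero}  Y k = k λ ()
    ¬¬-finite {m = suc m} Y k = ¬¬-finite (λ i → Y (suc i)) λ d →
      k λ { zero    → no λ y → k λ { zero → yes y ; (suc i) → d i }
          ; (suc i) → d i }

    select : ∀ {m} (R : Fin m → Op₂ 𝒮) (X : Pred (Op₂ 𝒮) ℓ) →
             (∀ i → Dec (X (R i))) →
             ∃[ xs ] All X xs × (∀ i x → x ≋ R i → X (R i) → Any (x ≋_) xs)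
    select {m = zero}  R X d = [] , [] , λ ()
    select {m = suc m} R X d
      with d zero | select (λ i → R (suc i)) X (λ i → d (suc i))
    ... | yes r | xs , all , any =
      R zero ∷ xs , r ∷ all ,
      λ { zero x x≋ _ → here x≋ ; (suc i) x x≋ r′ → there (any i x x≋ r′) }
    ... | no ¬r | xs , all , any =
      xs , all ,
      λ { zero x x≋ r → contradiction r ¬r ; (suc i) → any i }

  ⋃-unique : ∀ {X : Pred (Op₂ 𝒮) ℓ} {U V} → X ⊆ Basis →
             U Is⋃ X → V Is⋃ X → U ≋ V
  ⋃-unique {U = U} {V} X⊆ (xs , (Xxs , X⊆xs) , U≋) (ys , (Xys , X⊆ys) , V≋) s t =
    begin
      U s t                ≡⟨ U≋ s t ⟩
      ⨆ xs s t             ≡⟨ absorb* ys xs bys bxs (All.map (X⊆xs _) Xys) s t ⟨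
      ⨆ xs (⨆ ys s t) t    ≡⟨ push* xs ys bxs bys s t ⟨
      ⨆ ys (⨆ xs s t) t    ≡⟨ absorb* xs ys bxs bys (All.map (X⊆ys _) Xxs) s t ⟩
      ⨆ ys s t             ≡⟨ V≋ s t ⟨
      V s t                ∎
    where
    open ≡-Reasoning
    bxs = All.map X⊆ Xxs
    bys = All.map X⊆ Xys

  module _ {X : Pred (Op₂ 𝒮) ℓ} (X⊆ : X ⊆ Basis)
           (resp : ∀ {x y} → x ≋ y → X x → X y) where

    ⋃-exists : (∀ i → Dec (X (S i))) → ∃ (_Is⋃ X)
    ⋃-exists d with select S X d
    ... | xs , all , any = ⨆ xs , xs , (all , covers) , λ s t → refl
      where
      covers : ∀ x → X x → Any (x ≋_) xs
      covers x Xx with X⊆ Xx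
      ... | i , x≋ = any i x x≋ (resp x≋ Xx)

    ⋃-¬¬exists : ¬ ¬ ∃ (_Is⋃ X)
    ⋃-¬¬exists k = ¬¬-finite (λ i → X (S i)) λ d → k (⋃-exists d)

  BV-⊆ : (P : Program 𝒮 p) → BV P ⊆ Basis
  BV-⊆ P = proj₁

  BV-resp : (P : Program 𝒮 p) → ∀ {x y} → x ≋ y → BV P x → BV P y
  BV-resp P x≋y ((i , x≋) , s , s′ , Pss′ , ¬≈) =
    (i , λ u v → trans (sym (x≋y u v)) (x≋ u v)) ,
    s , s′ , Pss′ , λ y≈ → ¬≈ (trans (x≋y s s′) y≈)

{-# OPTIONS --safe #-}

-- Writing s′ for the merge of sQ and sP, it is obtained from sQ by overriding
-- basis scenes in BV P, none of which FQ depends on; hence FQ s′ ≡ FQ sQ.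
-- Conversely, overriding s′ by sP on every basis scene turns it into sP, and
-- each of these steps preserves FP: a scene in FV FP is not in BV Q, so on it
-- sQ agrees with s, and s′ agrees with sP, either because the scene is in BV P
-- and was merged, or because sP agrees with s on it as well.  Membership in
-- BV P is undecidable, but each step is a stable equality of Booleans.
module Submission where

open import Defs
open import Level using (Level)
open import Algebra.Core using (Op₂)
open import Data.Bool.Base as Bool using (true)
import Data.Bool.Properties as Bool
open import Data.Fin.Properties using (_≟_)
open import Data.List.Base using (List; []; _∷_; tabulate)
open import Data.List.Relation.Unary.All using (All; []; _∷_)
import Data.List.Relation.Unary.All as All
open import Data.List.Relation.Unary.All.Properties using (tabulate⁺)
open import Data.List.Relation.Unary.Any using (Any; here; there)
open import Data.Product.Base using (_×_; _,_; proj₁)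
open import Relation.Binary.PropositionalEquality
  using (_≡_; refl; sym; trans; cong; cong₂; module ≡-Reasoning)
open import Relation.Nullary using (¬_; yes; no; contradiction)
open import Relation.Nullary.Decidable using (decidable-stable)
open import Relation.Unary using (Pred)

private
  variable
    a ℓ : Level

-- The join of a list acts as successive overrides towards the same `t`, so an invariant only has to
-- survive one override at a time.
⨆-preserves : {𝒮 : Set a} (R : Pred 𝒮 ℓ) {t : 𝒮} (xs : List (Op₂ 𝒮)) →
              All (λ x → ∀ w → R w → R (x w t)) xs →
              ∀ {w} → R w → R (⨆ xs w t)
⨆-preserves R []       []       r = r
⨆-preserves R (x ∷ xs) (h ∷ hs) r = ⨆-preserves R xs hs (h _ r)

module _ {𝒮 : Set a} where

  module _ {A : Op₂ 𝒮} (isScene : IsScene A) where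

    open IsScene isScene

    ≈-sym : ∀ {s t} → s ≈ t on A → t ≈ s on A
    ≈-sym {s} {t} s≈t = begin
      A t s          ≡⟨ cong (A t) s≈t ⟨
      A t (A s t)    ≡⟨ overrideʳ t s t ⟩
      A t t          ≡⟨ idempotent t ⟩
      t              ∎
      where open ≡-Reasoning

    ≈-trans : ∀ {s t u} → s ≈ t on A → t ≈ u on A → s ≈ u on A
    ≈-trans {s} {t} {u} s≈t t≈u = begin
      A s u          ≡⟨ overrideʳ s t u ⟨
      A s (A t u)    ≡⟨ cong (A s) t≈u ⟩
      A s t          ≡⟨ s≈t ⟩
      s              ∎
      where open ≡-Reasoning

  IsScene-resp-≋ : {A B : Op₂ 𝒮} → A ≋ B → IsScene B → IsScene A
  IsScene-resp-≋ {A} {B} A≋B isScene = record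
    { overrideˡ  = λ x y z → trans (A≋B (A x y) z)
        (trans (cong (λ u → B u z) (A≋B x y))
               (trans (overrideˡ x y z) (sym (A≋B x z))))
    ; overrideʳ  = λ x y z → trans (A≋B x (A y z))
        (trans (cong (B x) (A≋B y z))
               (trans (overrideʳ x y z) (sym (A≋B x z))))
    ; idempotent = λ x → trans (A≋B x x) (idempotent x)
    }
    where open IsScene isScene

module _ {𝒮 : Set a} (𝓑 : SceneSpaceBasis 𝒮) where

  open SceneSpaceBasis 𝓑
  open SceneSpace 𝓑

  S∈Basis : ∀ i → Basis (S i)
  S∈Basis i = i , λ _ _ → refl

  Basis⇒IsScene : ∀ {x} → Basis x → IsScene x
  Basis⇒IsScene (i , x≋) = IsScene-resp-≋ x≋ (isScene i)

  -- With equal indices the second override absorbs into the first. Otherwise independence lets the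
  -- override on `x` go first, where it fixes `w`.
  override-≈ : ∀ {x y} → Basis x → Basis y →
               ∀ {w t} → w ≈ t on x → y w t ≈ t on x
  override-≈ {x} {y} (i , x≋) (j , y≋) {w} {t} w≈t with i ≟ j
  ... | yes refl = begin
    x (y w t) t        ≡⟨ x≋ (y w t) t ⟩
    S i (y w t) t      ≡⟨ cong (λ u → S i u t) (y≋ w t) ⟩
    S i (S i w t) t    ≡⟨ IsScene.overrideˡ (isScene i) w t t ⟩
    S i w t            ≡⟨ y≋ w t ⟨
    y w t              ∎
    where open ≡-Reasoning
  ... | no i≢j = begin
    x (y w t) t        ≡⟨ x≋ (y w t) t ⟩
    S i (y w t) t      ≡⟨ cong (λ u → S i u t) (y≋ w t) ⟩
    S i (S j w t) t    ≡⟨ independent i≢j w t t ⟨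
    S j (S i w t) t    ≡⟨ cong (λ u → S j u t) (x≋ w t) ⟨
    S j (x w t) t      ≡⟨ cong (λ u → S j u t) w≈t ⟩
    S j w t            ≡⟨ y≋ w t ⟨
    y w t              ∎
    where open ≡-Reasoning

  ⨆-≈ : ∀ {x} → Basis x → ∀ {xs} → All Basis xs →
        ∀ {w t} → w ≈ t on x → ⨆ xs w t ≈ t on x
  ⨆-≈ {x} bx {xs} bxs {t = t} =
    ⨆-preserves (_≈ t on x) xs (All.map (λ by _ → override-≈ bx by) bxs)

  -- The override at the occurrence of `x` creates the agreement, and the later ones keep it.
  ∈-⨆-≈ : ∀ {x} → Basis x → ∀ {xs} → All Basis xs → Any (x ≋_) xs →
          ∀ w t → ⨆ xs w t ≈ t on x
  ∈-⨆-≈ {x} bx {y ∷ _} (_ ∷ bys) (here x≋y) w t = ⨆-≈ bx bys (begin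
    x (y w t) t    ≡⟨ cong (λ u → x u t) (x≋y w t) ⟨
    x (x w t) t    ≡⟨ IsScene.overrideˡ (Basis⇒IsScene bx) w t t ⟩
    x w t          ≡⟨ x≋y w t ⟩
    y w t          ∎)
    where open ≡-Reasoning
  ∈-⨆-≈ bx (_ ∷ bys) (there x∈ys) w t = ∈-⨆-≈ bx bys x∈ys _ t

  FV-override : ∀ (F : Formula 𝒮) {x} → Basis x → ∀ {w t} →
                (FV F x → ¬ ¬ (w ≈ t on x)) → F (x w t) ≡ F w
  FV-override F {x} bx {w} {t} h =
    decidable-stable (F (x w t) Bool.≟ F w) λ F≢ →
      -- If `F` changed, `x w t` and `w`, which agree on `x ᶜ`, would put `x` in `FV F`. But then
      -- `w ≈ t on x` makes the override trivial.
      h (bx , x w t , w , IsScene.overrideʳ (Basis⇒IsScene bx) w w t , F≢)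
        λ w≈t → F≢ (cong F w≈t)

  ⨆-∉FV : ∀ (F : Formula 𝒮) {xs} → All Basis xs →
          All (λ x → ¬ FV F x) xs → ∀ w t → F (⨆ xs w t) ≡ F w
  ⨆-∉FV F {xs} bxs ∉FV w t =
    ⨆-preserves (λ v → F v ≡ F w) xs
      (All.zipWith
        (λ (bx , x∉FV) _ → trans (FV-override F bx λ x∈FV → contradiction x∈FV x∉FV))
        (bxs , ∉FV))
      refl

  -- By `total`, overriding `w` by `t` on every basis scene in turn ends in `t`.
  FV-agree : ∀ (F : Formula 𝒮) {w t} →
             (∀ i → FV F (S i) → ¬ ¬ (w ≈ t on S i)) → F t ≡ F w
  FV-agree F {w} {t} h = trans (cong F (sym (total w t))) (proj₁ final)
    where
    -- The second component carries agreement at the start `w`, which is all that `h` speaks of,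
    -- over to each intermediate state `v`.
    R : Pred 𝒮 _
    R v = F v ≡ F w × (∀ i → w ≈ t on S i → v ≈ t on S i)

    step : ∀ i v → R v → R (S i v t)
    step i v (Fv≡Fw , w≈⇒v≈) =
      trans (FV-override F (S∈Basis i) λ i∈FV ¬v≈ →
               h i i∈FV λ w≈ → ¬v≈ (w≈⇒v≈ i w≈))
            Fv≡Fw ,
      λ j w≈ → override-≈ (S∈Basis j) (S∈Basis i) (w≈⇒v≈ j w≈)

    final : R (⨆ (tabulate S) w t)
    final = ⨆-preserves R (tabulate S) (tabulate⁺ step) (refl , λ _ w≈ → w≈)

theorem49 : ∀ {a p q} {𝒮 : Set a} → 𝒮 → (𝓑 : SceneSpaceBasis 𝒮) → let open SceneSpace 𝓑 in
    (P : Program 𝒮 p) (Q : Program 𝒮 q) (FP FQ : Formula 𝒮) →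
    P DoesNotInterfereWith FQ → Q DoesNotInterfereWith FP →
    ∀ s → ([ P ] FP) s → ([ Q ] FQ) s → ([ P ∥ Q ] (FP ∧ FQ)) s
theorem49 {𝒮 = 𝒮} _ 𝓑 P Q FP FQ P#FQ Q#FP s □FP □FQ s′
  (sP , sQ , Psp , Qsq , mrg , (xs , (xs⊆BV , BV⊆xs) , mrg≋) , s′≡) =
  cong₂ Bool._∧_ FP≡true FQ≡true
  where
  open SceneSpaceBasis 𝓑
  open SceneSpace 𝓑

  m : 𝒮
  m = ⨆ xs sQ sP

  s′≡m : s′ ≡ m
  s′≡m = trans s′≡ (mrg≋ sQ sP)

  bxs : All Basis xs
  bxs = All.map proj₁ xs⊆BV

  agree : ∀ i → FV FP (S i) → ¬ ¬ (m ≈ sP on S i)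
  agree i i∈FV ¬m≈sP =
    -- With `s` as the link, `sQ` already agrees with `sP` on `S i`, and merging keeps this.
    ¬¬s≈sQ λ s≈sQ → ¬¬s≈sP λ s≈sP →
      ¬m≈sP (⨆-≈ 𝓑 bi bxs (≈-trans (isScene i) (≈-sym (isScene i) s≈sQ) s≈sP))
    where
    bi = S∈Basis 𝓑 i

    ¬¬s≈sQ : ¬ ¬ (s ≈ sQ on S i)
    ¬¬s≈sQ s≉sQ = Q#FP (S i) ((bi , s , sQ , Qsq , s≉sQ) , i∈FV)

    -- A disagreement puts `S i` in `BV P`, hence in the listing `xs`, so the merge has made `m`
    -- agree with `sP` there.
    ¬¬s≈sP : ¬ ¬ (s ≈ sP on S i)
    ¬¬s≈sP s≉sP =
      ¬m≈sP (∈-⨆-≈ 𝓑 bi bxs (BV⊆xs (S i) (bi , s , sP , Psp , s≉sP)) sQ sP)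

  FP≡true : FP s′ ≡ true
  FP≡true = trans (cong FP s′≡m) (trans (sym (FV-agree 𝓑 FP agree)) (□FP sP Psp))

  FQ≡true : FQ s′ ≡ true
  FQ≡true = trans (cong FQ s′≡m)
    (trans (⨆-∉FV 𝓑 FQ bxs (All.map (λ x∈BV x∈FV → P#FQ _ (x∈BV , x∈FV)) xs⊆BV) sQ sP)
           (□FQ sQ Qsq))
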